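{- Consider the unweighted throughput scheduling problem on one machine in the preemption-revoke model. For every deterministic online algorithm $\mathsf{ALG}$ and every integer $k\ge 3$, there exists an instance on which $\mathsf{ALG}$ completes at most one job while an optimal offline schedule $\mathsf{OPT}$ completes at least $k$ jobs. Therefore, no deterministic online algorithm can achieve a constant competitive ratio in the preemption-revoke model; that is, for no real constant $c>0$ does there exist a $c$-competitive deterministic online algorithm.
   Context: Time is continuous (real numbers). A job is a triple $J_i=(r_i,p_i,s_i)$ of real numbers with release time $r_i$, processing time $p_i>0$ and slack $s_i\ge 0$. It cannot be started before $r_i$ and must start no later than $r_i+s_i$ (latest-start constraint). Its deadline is $d_i:=r_i+p_i+s_i$, and $[r_i,d_i)$ is its time window. An instance is a finite collection of jobs. There is a single machine, which processes at most one job at any time; processing intervals are half-open $[a,b)$, so the machine may complete a job and immediately start another at the same time. Preemption-revoke model: a job $J_i$ may be started at most once, at some time $a_i$ with $r_i\le a_i\le r_i+s_i$. Once started, it is processed continuously until either it is completed at time $a_i+p_i$ or it is revoked (aborted) at some earlier time. If it is revoked, all progress on it is permanently lost and it can neither be resumed nor restarted. The objective is to maximize the number of completed jobs (all jobs have equal weight). Deterministic online algorithm: a job (with all its parameters $r_i,p_i,s_i$) becomes known to the algorithm at its release time $r_i$. The algorithm's decisions (starting, continuing, revoking, idling) up to and including time $t$ are a deterministic function of the jobs with release time at most $t$; that is, if two instances have the same jobs with release time at most $t$, the algorithm makes the same decisions on both up to and including time $t$. The algorithm does not know future jobs. $\mathsf{ALG}$ also denotes the number of jobs completed by the algorithm on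 a given instance. $\mathsf{OPT}$ denotes an optimal offline schedule, which knows the whole instance in advance, as well as the number of jobs it completes, i.e. the maximum number of jobs of the instance that can be completed by processing each chosen job $J_i$ without interruption on an interval $[a_i,a_i+p_i)$ with $r_i\le a_i\le r_i+s_i$, these intervals being pairwise disjoint. Competitive ratios are expressed as $\mathsf{ALG}/\mathsf{OPT}\le 1$: an algorithm is $c$-competitive if $\mathsf{ALG}\ge c\cdot\mathsf{OPT}$ on every instance. -}

module Defs where

open import Algebra.Structures using (IsCommutativeRing)
open import Data.Bool.Base using (Bool; true; false)
open import Data.Empty using (⊥)
open import Data.Fin.Base using (Fin)
open import Data.List.Base using (List; length; lookup; map; filter; filterᵇ; allFin)
open import Data.Maybe.Base using (Maybe; just; nothing; is-just)
open import Data.Nat.Base as ℕ using (ℕ; zero; suc)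
open import Data.Product.Base using (∃; _×_)
open import Data.Unit.Base using (⊤)
open import Function.Base using (_∘_)
open import Relation.Binary.Definitions using (Decidable)
open import Relation.Binary.PropositionalEquality using (_≡_; _≢_)
open import Relation.Binary.Structures using (IsStrictTotalOrder)
import Relation.Binary.Construct.StrictToNonStrict as StrictToNonStrict
open import Relation.Nullary using (¬_; yes; no)

-- The real numbers, given axiomatically as a complete ordered field; classically
-- these axioms determine ℝ up to unique isomorphism.  The trichotomy contained
-- in IsStrictTotalOrder makes the order decidable, as in classical analysis.
record RealNumbers : Set₁ where
  infix  8 -_
  infixl 7 _*_
  infixl 6 _+_
  infix  4 _<_ _≤?_
  field
    ℝ                  : Set
    _+_ _*_            : ℝ → ℝ → ℝ
    -_                 : ℝ → ℝ
    0# 1#              : ℝ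
    _<_                : ℝ → ℝ → Set
    isCommutativeRing  : IsCommutativeRing _≡_ _+_ _*_ -_ 0# 1#
    0≢1                : 0# ≢ 1#
    inverse            : ∀ x → x ≢ 0# → ∃ λ y → x * y ≡ 1#
    isStrictTotalOrder : IsStrictTotalOrder _≡_ _<_
    +-monoˡ-<          : ∀ {x y} z → x < y → x + z < y + z
    *-pos              : ∀ {x y} → 0# < x → 0# < y → 0# < x * y

  open StrictToNonStrict _≡_ _<_ public using (_≤_)

  _≤?_ : Decidable _≤_
  _≤?_ = StrictToNonStrict.decidable′ _≡_ _<_
           (IsStrictTotalOrder.compare isStrictTotalOrder)

  UpperBound : (ℝ → Set) → ℝ → Set
  UpperBound P b = ∀ x → P x → x ≤ b

  field
    supremum : (P : ℝ → Set) → ∃ P → ∃ (UpperBound P) →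
               ∃ λ s → UpperBound P s × (∀ b → UpperBound P b → s ≤ b)

  fromℕ : ℕ → ℝ
  fromℕ zero    = 0#
  fromℕ (suc n) = fromℕ n + 1#

module Scheduling (R : RealNumbers) where
  open RealNumbers R

  -- The side conditions are irrelevant, so a job is determined by its triple.
  record Job : Set where
    constructor job
    field
      release processing slack : ℝ
      .processing-pos          : 0# < processing
      .slack-nonneg            : 0# ≤ slack

  open Job public using (release; processing; slack)

  -- The same triple may occur several times; jobs are identified by position.
  Instance : Set
  Instance = List Job

  JobId : Instance → Set
  JobId I = Fin (length I)

  _∈[_,_⟩ : ℝ → ℝ → ℝ → Set
  t ∈[ a , b ⟩ = a ≤ t × t < b

  AdmissibleStart : Job → ℝ → Set
  AdmissibleStart J a = release J ≤ a × a ≤ release J + slack J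

  PairwiseDisjoint : {A : Set} → (A → ℝ → Set) → Set
  PairwiseDisjoint {A} S = ∀ (i j : A) → i ≢ j → ∀ t → ¬ (S i t × S j t)

  data Outcome : Set where
    unstarted : Outcome
    completed : (start : ℝ) → Outcome
    revoked   : (start end : ℝ) → Outcome

  -- Revoking at the very instant of starting is allowed; this only enlarges
  -- the class of algorithms.
  Feasible : Job → Outcome → Set
  Feasible J unstarted     = ⊤
  Feasible J (completed a) = AdmissibleStart J a
  Feasible J (revoked a b) = AdmissibleStart J a × a ≤ b × b < a + processing J

  Busy : Job → Outcome → ℝ → Set
  Busy J unstarted     t = ⊥
  Busy J (completed a) t = t ∈[ a , a + processing J ⟩
  Busy J (revoked a b) t = t ∈[ a , b ⟩

  isCompleted : Outcome → Bool
  isCompleted (completed _) = true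
  isCompleted _             = false

  record RevokeSchedule (I : Instance) : Set where
    field
      outcome  : JobId I → Outcome
      feasible : ∀ i → Feasible (lookup I i) (outcome i)
      disjoint : PairwiseDisjoint (λ i → Busy (lookup I i) (outcome i))

    throughput : ℕ
    throughput = length (filterᵇ (isCompleted ∘ outcome) (allFin (length I)))

  -- What has been decided about a job up to and including a given time.
  -- Completion is not a separate decision: it is a start without a revocation.
  data Decision : Set where
    notStarted     : Decision
    started        : (start : ℝ) → Decision
    startedRevoked : (start end : ℝ) → Decision

  decisionAt : ℝ → Outcome → Decision
  decisionAt t unstarted = notStarted
  decisionAt t (completed a) with a ≤? t
  ... | yes _ = started a
  ... | no  _ = notStarted
  decisionAt t (revoked a b) with a ≤? t | b ≤? t
  ... | no  _ | _     = notStarted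
  ... | yes _ | no  _ = started a
  ... | yes _ | yes _ = startedRevoked a b

  known : ℝ → Instance → List Job
  known t = filter (λ J → release J ≤? t)

  -- The decisions up to and including time t on the jobs of `known t I`, in the
  -- same order.  All other jobs are released after t, hence not started by then.
  decisions : ∀ t {I} → RevokeSchedule I → List Decision
  decisions t {I} S =
    map (decisionAt t ∘ RevokeSchedule.outcome S)
        (filter (λ i → release (lookup I i) ≤? t) (allFin (length I)))

  record OnlineAlgorithm : Set where
    field
      run             : (I : Instance) → RevokeSchedule I
      nonanticipating : ∀ t I I′ → known t I ≡ known t I′ →
                        decisions t (run I) ≡ decisions t (run I′)

    completions : Instance → ℕ
    completions I = RevokeSchedule.throughput (run I)

  OfflineBusy : Job → Maybe ℝ → ℝ → Set
  OfflineBusy J nothing  t = ⊥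
  OfflineBusy J (just a) t = t ∈[ a , a + processing J ⟩

  record OfflineSchedule (I : Instance) : Set where
    field
      start      : JobId I → Maybe ℝ
      admissible : ∀ i a → start i ≡ just a → AdmissibleStart (lookup I i) a
      disjoint   : PairwiseDisjoint (λ i → OfflineBusy (lookup I i) (start i))

    throughput : ℕ
    throughput = length (filterᵇ (is-just ∘ start) (allFin (length I)))

  open OfflineSchedule using (throughput)

  IsOptimal : ∀ {I} → OfflineSchedule I → Set
  IsOptimal {I} S = (S′ : OfflineSchedule I) → throughput S′ ℕ.≤ throughput S

  Competitive : ℝ → OnlineAlgorithm → Set
  Competitive c ALG =
    ∀ I (OPT : OfflineSchedule I) → IsOptimal OPT →
    c * fromℕ (throughput OPT) ≤ fromℕ (OnlineAlgorithm.completions ALG I)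

{-# OPTIONS --safe #-}

-- The adversary keeps a nonempty interval [t, T) during which the algorithm is
-- either idle or processing a job that it cannot complete before T, and which
-- an offline plan for all jobs released so far leaves free.  It releases inside
-- this interval a job J = (r, p, p) whose whole window fits, and uses that J
-- can be planned either at r or at r + p:
--   if J is never started, plan it at r and continue with [r + p, T);
--   if J is started at r + p, plan it at r and continue with [r + p, r + 2p);
--   if J is started at a < r + p, plan it at r + p and continue with [a, r + p).
-- To take up a new job the algorithm has to revoke the previous one for good, and
-- an ignored job has expired, so at most one job is ever completed, although
-- the plan serves all of them.
module Submission where

open import Defs
open import Data.Nat.Base using (ℕ; _≤_)
open import Data.Product.Base using (Σ-syntax; _×_)
open import Relation.Nullary using (¬_)

open import Algebra.Bundles using (CommutativeRing)
import Algebra.Properties.Ring as RingProperties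
open import Data.Bool.Base using () renaming (T to IsTrue)
open import Data.Fin.Base using (Fin; zero; suc)
open import Data.Fin.Properties using (_≟_)
open import Data.List.Base using ([]; _∷_; length; lookup; map; filter; tabulate; allFin)
open import Data.List.Properties
  using (∷-injective; filter-all; filter-reject; length-filter; length-tabulate; map-tabulate)
open import Data.List.Relation.Unary.All using (All; []; _∷_)
import Data.List.Relation.Unary.All.Properties as All
open import Data.List.Relation.Unary.AllPairs.Core using ([]; _∷_)
open import Data.List.Relation.Unary.Unique.Propositional using (Unique)
import Data.List.Relation.Unary.Unique.Propositional.Properties as Unique
open import Data.Maybe.Base using (Maybe; just; is-just)
import Data.Nat.Base as ℕ
import Data.Nat.Properties as ℕ
open import Data.Product.Base using (∃; _,_; proj₁; proj₂)
open import Data.Sum.Base using (_⊎_; inj₁; inj₂)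
open import Data.Unit.Base using (⊤; tt)
open import Function.Base using (_∘_; _$_)
open import Relation.Binary.Bundles using (StrictTotalOrder)
open import Relation.Binary.Definitions using (tri<; tri≈; tri>)
open import Relation.Binary.PropositionalEquality
  using (_≡_; refl; sym; trans; cong; cong₂; subst; subst₂; module ≡-Reasoning)
import Relation.Binary.Properties.StrictTotalOrder as StrictTotalOrderProperties
open import Relation.Unary using (Decidable)
open import Relation.Nullary using (yes; no; contradiction; T?)

-- Lists: equal tabulations and duplicate-free lists.

tabulate-injective : ∀ {A : Set} {n} {f g : Fin n → A} → tabulate f ≡ tabulate g → ∀ i → f i ≡ g i
tabulate-injective eq zero    = proj₁ (∷-injective eq)
tabulate-injective eq (suc i) = tabulate-injective (proj₂ (∷-injective eq)) i

-- Two entries of a duplicate-free list would be distinct, yet identified by `same`. This turns a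
-- statement about pairs of completed jobs into a bound on the throughput.
length-unique≤1 : ∀ {A : Set} {P : A → Set} → (∀ {x y} → P x → P y → x ≡ y) →
                  ∀ {xs} → Unique xs → All P xs → length xs ≤ 1
length-unique≤1 same {[]}         _                 _              = ℕ.z≤n
length-unique≤1 same {_ ∷ []}     _                 _              = ℕ.s≤s ℕ.z≤n
length-unique≤1 same {_ ∷ _ ∷ _} ((x≢y ∷ _) ∷ _) (px ∷ py ∷ _) = contradiction (same px py) x≢y

-- Arithmetic in an ordered field and the Archimedean property.

module OrderedField (R : RealNumbers) where
  open RealNumbers R hiding (_≤_)
  open RealNumbers R public using () renaming (_≤_ to _≤ℝ_)

  ring : CommutativeRing _ _
  ring = record { isCommutativeRing = isCommutativeRing }

  open CommutativeRing ring public
    using (+-identityˡ; +-identityʳ; +-assoc; +-comm; -‿inverseˡ; -‿inverseʳ; *-identityʳ; *-comm; distribˡ)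
  open RingProperties (CommutativeRing.ring ring) using (-1*x≈-x; -‿involutive)

  <-strictTotalOrder : StrictTotalOrder _ _ _
  <-strictTotalOrder = record { isStrictTotalOrder = isStrictTotalOrder }

  open StrictTotalOrder <-strictTotalOrder public
    using (compare; asym; irrefl) renaming (trans to <-trans; strictPartialOrder to <-strictPartialOrder)
  open StrictTotalOrderProperties <-strictTotalOrder public
    using () renaming (refl to ≤-refl; trans to ≤-trans)

  open import Relation.Binary.Reasoning.StrictPartialOrder <-strictPartialOrder

  <⇒≤ : ∀ {x y} → x < y → x ≤ℝ y
  <⇒≤ = inj₁

  <-≤-trans : ∀ {x y z} → x < y → y ≤ℝ z → x < z
  <-≤-trans x<y (inj₁ y<z)  = <-trans x<y y<z
  <-≤-trans x<y (inj₂ refl) = x<y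

  ≤-<-trans : ∀ {x y z} → x ≤ℝ y → y < z → x < z
  ≤-<-trans (inj₁ x<y)  y<z = <-trans x<y y<z
  ≤-<-trans (inj₂ refl) y<z = y<z

  <⇒≱ : ∀ {x y} → x < y → ¬ y ≤ℝ x
  <⇒≱ x<y y≤x = irrefl refl (<-≤-trans x<y y≤x)

  ≰⇒> : ∀ {x y} → ¬ x ≤ℝ y → y < x
  ≰⇒> {x} {y} x≰y with compare x y
  ... | tri< x<y _ _ = contradiction (inj₁ x<y) x≰y
  ... | tri≈ _ x≡y _ = contradiction (inj₂ x≡y) x≰y
  ... | tri> _ _ y<x = y<x

  +-monoˡ-≤ : ∀ {x y} z → x ≤ℝ y → x + z ≤ℝ y + z
  +-monoˡ-≤ z (inj₁ x<y)  = inj₁ (+-monoˡ-< z x<y)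
  +-monoˡ-≤ z (inj₂ refl) = inj₂ refl

  x<x+p : ∀ x {p} → 0# < p → x < x + p
  x<x+p x {p} 0<p = subst₂ _<_ (+-identityˡ x) (+-comm p x) (+-monoˡ-< x 0<p)

  x+p≤x : ∀ x {p} → p ≤ℝ 0# → x + p ≤ℝ x
  x+p≤x x {p} p≤0 = subst₂ _≤ℝ_ (+-comm p x) (+-identityˡ x) (+-monoˡ-≤ x p≤0)

  0<1 : 0# < 1#
  0<1 with compare 0# 1#
  ... | tri< 0<1 _ _ = 0<1
  ... | tri≈ _ 0≡1 _ = contradiction 0≡1 0≢1
  -- If `1# < 0#`, then `- 1#` is positive, and so is its square, which is `1#`.
  ... | tri> _ _ 1<0 = contradiction (subst (0# <_) (trans (-1*x≈-x (- 1#)) (-‿involutive 1#)) (*-pos 0<-1 0<-1)) (asym 1<0)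
    where
    0<-1 : 0# < - 1#
    0<-1 = subst₂ _<_ (-‿inverseʳ 1#) (+-identityˡ (- 1#)) (+-monoˡ-< (- 1#) 1<0)

  halve : ∀ z → ∃ λ p → p + p ≡ z
  halve z = z * h , eq
    where
    0<2 : 0# < 1# + 1#
    0<2 = <-trans 0<1 (x<x+p 1# 0<1)

    1/2 : ∃ λ h → (1# + 1#) * h ≡ 1#
    1/2 = inverse (1# + 1#) λ 2≡0 → irrefl (sym 2≡0) 0<2

    h = proj₁ 1/2

    eq : z * h + z * h ≡ z
    eq = begin-equality
      z * h + z * h       ≡⟨ distribˡ z h h ⟨
      z * (h + h)         ≡⟨ cong (z *_) (cong₂ _+_ (*-identityʳ h) (*-identityʳ h)) ⟨
      z * (h * 1# + h * 1#) ≡⟨ cong (z *_) (distribˡ h 1# 1#) ⟨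
      z * (h * (1# + 1#)) ≡⟨ cong (z *_) (trans (*-comm h (1# + 1#)) (proj₂ 1/2)) ⟩
      z * 1#              ≡⟨ *-identityʳ z ⟩
      z                   ∎

  bisect : ∀ {x y} → x < y → ∃ λ p → 0# < p × x + p + p ≡ y
  bisect {x} {y} x<y with halve (y + - x)
  ... | p , p+p≡y-x = p , 0<p , eq
    where
    eq : x + p + p ≡ y
    eq = begin-equality
      x + p + p      ≡⟨ +-assoc x p p ⟩
      x + (p + p)    ≡⟨ cong (x +_) p+p≡y-x ⟩
      x + (y + - x)  ≡⟨ +-comm x (y + - x) ⟩
      y + - x + x    ≡⟨ +-assoc y (- x) x ⟩
      y + (- x + x)  ≡⟨ cong (y +_) (-‿inverseˡ x) ⟩
      y + 0#         ≡⟨ +-identityʳ y ⟩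
      y              ∎

    0<p : 0# < p
    -- Were `p` not positive, `x + p + p` would be at most `x`, against `x < y`.
    0<p = ≰⇒> λ p≤0 → <⇒≱ x<y $ subst (_≤ℝ x) eq (≤-trans (x+p≤x (x + p) p≤0) (x+p≤x x p≤0))

  *-monoʳ-≤ : ∀ {c} → 0# < c → ∀ {x y} → x ≤ℝ y → c * x ≤ℝ c * y
  *-monoʳ-≤ 0<c (inj₂ refl) = inj₂ refl
  *-monoʳ-≤ {c} 0<c {x} {y} (inj₁ x<y) with bisect x<y
  -- With `y` written as `x + p + p`, the product `c * y` exceeds `c * x` by two positive terms
  -- `c * p`.
  ... | p , 0<p , refl = inj₁ $ begin-strict
    c * x                  <⟨ x<x+p (c * x) (*-pos 0<c 0<p) ⟩
    c * x + c * p          <⟨ x<x+p (c * x + c * p) (*-pos 0<c 0<p) ⟩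
    c * x + c * p + c * p  ≡⟨ cong (_+ c * p) (distribˡ c x p) ⟨
    c * (x + p) + c * p    ≡⟨ distribˡ c (x + p) p ⟨
    c * (x + p + p)        ∎

  0≤fromℕ : ∀ n → 0# ≤ℝ fromℕ n
  0≤fromℕ ℕ.zero    = ≤-refl
  0≤fromℕ (ℕ.suc n) = ≤-trans (0≤fromℕ n) (<⇒≤ (x<x+p (fromℕ n) 0<1))

  fromℕ-mono : ∀ {m n} → m ≤ n → fromℕ m ≤ℝ fromℕ n
  fromℕ-mono {n = n} ℕ.z≤n = 0≤fromℕ n
  fromℕ-mono (ℕ.s≤s m≤n)   = +-monoˡ-≤ 1# (fromℕ-mono m≤n)

  -- The Archimedean property, from completeness: if the multiples of `c` had a supremum `s`, then
  -- `c * n + c = c * (n + 1) ≤ s` would make `s - c` a smaller upper bound.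
  multiples-unbounded : ∀ {c} → 0# < c → ∀ b → ¬ (∀ n → c * fromℕ n ≤ℝ b)
  multiples-unbounded {c} 0<c b bounded
    with supremum (λ x → ∃ λ n → x ≡ c * fromℕ n) (_ , 0 , refl) (b , λ { _ (n , refl) → bounded n })
  ... | s , upper , least = <⇒≱ (x<x+p s 0<c) (subst (s + c ≤ℝ_) s-c+c≡s (+-monoˡ-≤ c (least (s + - c) below)))
    where
    s-c+c≡s : s + - c + c ≡ s
    s-c+c≡s = trans (+-assoc s (- c) c) (trans (cong (s +_) (-‿inverseˡ c)) (+-identityʳ s))

    below : UpperBound (λ x → ∃ λ n → x ≡ c * fromℕ n) (s + - c)
    below _ (n , refl) = begin
      c * fromℕ n                    ≡⟨ +-identityʳ (c * fromℕ n) ⟨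
      c * fromℕ n + 0#               ≡⟨ cong (c * fromℕ n +_) (-‿inverseʳ c) ⟨
      c * fromℕ n + (c + - c)        ≡⟨ +-assoc (c * fromℕ n) c (- c) ⟨
      c * fromℕ n + c + - c          ≡⟨ cong (λ d → c * fromℕ n + d + - c) (*-identityʳ c) ⟨
      c * fromℕ n + c * 1# + - c     ≡⟨ cong (_+ - c) (distribˡ c (fromℕ n) 1#) ⟨
      c * fromℕ (ℕ.suc n) + - c      ≤⟨ +-monoˡ-≤ (- c) (upper _ (ℕ.suc n , refl)) ⟩
      s + - c                        ∎

-- Outcomes and decisions of a single job.

module Adversary (R : RealNumbers) where
  open RealNumbers R hiding (_≤_)
  open OrderedField R
  open Scheduling R
  open OfflineSchedule

  -- Retains only the start time: the adversary reacts in the same way whether the job is later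
  -- completed or revoked.
  data StartsAt : Outcome → ℝ → Set where
    completed : ∀ {a} → StartsAt (completed a) a
    revoked   : ∀ {a b} → StartsAt (revoked a b) a

  starts? : ∀ {J} o → Feasible J o → o ≡ unstarted ⊎ ∃ λ a → StartsAt o a × AdmissibleStart J a
  starts? unstarted     _         = inj₁ refl
  starts? (completed a) adm       = inj₂ (a , completed , adm)
  starts? (revoked a b) (adm , _) = inj₂ (a , revoked , adm)

  -- A job with this decision at time t cannot be completed before T unless it
  -- is revoked, and cannot be started after t.
  Settled : ℝ → ℝ → Job → Decision → Set
  Settled t T J notStarted           = release J + slack J ≤ℝ t
  Settled t T J (started a)          = T ≤ℝ a + processing J
  Settled t T J (startedRevoked a b) = ⊤

  -- An expired job stays unstarted, since an admissible start after `t` would exceed its latest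
  -- start time. A started job can only become revoked, and lowering `T` weakens the bound on its
  -- completion time.
  settled-mono : ∀ {t T t′ T′ J} o → Feasible J o → t ≤ℝ t′ → T′ ≤ℝ T →
                 Settled t T J (decisionAt t o) → Settled t′ T′ J (decisionAt t′ o)
  settled-mono unstarted _ t≤t′ T′≤T expired = ≤-trans expired t≤t′
  settled-mono {t} {T} {t′} (completed a) (_ , a≤d) t≤t′ T′≤T s with a ≤? t | a ≤? t′
  ... | yes _   | yes _    = ≤-trans T′≤T s
  ... | yes a≤t | no  a≰t′ = contradiction (≤-trans a≤t t≤t′) a≰t′
  ... | no  a≰t | _        = contradiction (≤-trans a≤d s) a≰t
  settled-mono {t} {T} {t′} (revoked a b) ((_ , a≤d) , _) t≤t′ T′≤T s with a ≤? t | b ≤? t | a ≤? t′ | b ≤? t′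
  ... | no  a≰t | _       | _        | _        = contradiction (≤-trans a≤d s) a≰t
  ... | yes a≤t | _       | no  a≰t′ | _        = contradiction (≤-trans a≤t t≤t′) a≰t′
  ... | yes _   | yes b≤t | yes _    | no  b≰t′ = contradiction (≤-trans b≤t t≤t′) b≰t′
  ... | yes _   | _       | yes _    | yes _    = tt
  ... | yes _   | no  _   | yes _    | no  _    = ≤-trans T′≤T s

  -- Decisions at time `a` include a start at `a`, so `J` is already running then, or was revoked at
  -- that very instant.
  settled-start : ∀ {a T J o} → StartsAt o a → T ≤ℝ a + processing J → Settled a T J (decisionAt a o)
  settled-start {a} completed T≤ with a ≤? a
  ... | yes _   = T≤
  ... | no  a≰a = contradiction ≤-refl a≰a
  settled-start {a} (revoked {b = b}) T≤ with a ≤? a | b ≤? a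
  ... | yes _   | yes _ = tt
  ... | yes _   | no  _ = T≤
  ... | no  a≰a | _     = contradiction ≤-refl a≰a

  -- A completed job that is settled must have started by `t`, because otherwise it would have
  -- expired, and it ends no earlier than `T`; hence it occupies the instant `t`.
  settled⇒busy : ∀ {t T J} o → t < T → Feasible J o → IsTrue (isCompleted o) →
                 Settled t T J (decisionAt t o) → Busy J o t
  settled⇒busy {t} (completed a) t<T (_ , a≤d) _ s with a ≤? t
  ... | yes a≤t = a≤t , <-≤-trans t<T s
  ... | no  a≰t = contradiction (≤-trans a≤d s) a≰t

  -- Offline plans and their extension by one job.

  Planned : ∀ {I} → OfflineSchedule I → Set
  Planned plan = ∀ i → IsTrue (is-just (start plan i))

  Avoids : ∀ {I} → OfflineSchedule I → ℝ → ℝ → Set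
  Avoids {I} plan t T = ∀ i x → OfflineBusy (lookup I i) (start plan i) x → ¬ x ∈[ t , T ⟩

  throughput-planned : ∀ {I} (plan : OfflineSchedule I) → Planned plan → throughput plan ≡ length I
  throughput-planned {I} plan planned =
    trans (cong length (filter-all (T? ∘ is-just ∘ start plan) (All.tabulate⁺ planned)))
          (length-tabulate {n = length I} _)

  throughput≤length : ∀ {I} (plan : OfflineSchedule I) → throughput plan ≤ length I
  throughput≤length {I} plan =
    ℕ.≤-trans (length-filter (T? ∘ is-just ∘ start plan) (allFin (length I)))
              (ℕ.≤-reflexive (length-tabulate {n = length I} _))

  extendPlan : ∀ {I t T} (plan : OfflineSchedule I) → Avoids plan t T →
               ∀ J a → AdmissibleStart J a → t ≤ℝ a → a + processing J ≤ℝ T → OfflineSchedule (J ∷ I)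
  extendPlan {I} {t} {T} plan avoids J a adm t≤a end≤T = record
    { start      = start′
    ; admissible = λ { zero _ refl → adm ; (suc i) → admissible plan i }
    ; disjoint   = disjoint′
    }
    where
    start′ : JobId (J ∷ I) → Maybe ℝ
    start′ zero    = just a
    start′ (suc i) = start plan i

    free : ∀ i x → OfflineBusy (lookup I i) (start plan i) x → ¬ x ∈[ a , a + processing J ⟩
    free i x busy (a≤x , x<end) = avoids i x busy (≤-trans t≤a a≤x , <-≤-trans x<end end≤T)

    disjoint′ : PairwiseDisjoint (λ i → OfflineBusy (lookup (J ∷ I) i) (start′ i))
    disjoint′ zero    zero    i≢j x _              = i≢j refl
    disjoint′ zero    (suc j) _   x (busyᴶ , busy) = free j x busy busyᴶ
    disjoint′ (suc i) zero    _   x (busy , busyᴶ) = free i x busy busyᴶ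
    disjoint′ (suc i) (suc j) i≢j x                = disjoint plan i j (i≢j ∘ cong suc) x

  -- Independence of decisions from future jobs.

  module _ (ALG : OnlineAlgorithm) where
    open OnlineAlgorithm ALG
    open RevokeSchedule using (outcome; feasible)

    ReleasedBy : ℝ → Instance → Set
    ReleasedBy t I = ∀ i → release (lookup I i) ≤ℝ t

    releasedBy? : ∀ t I → Decidable (λ (i : JobId I) → release (lookup I i) ≤ℝ t)
    releasedBy? t I i = release (lookup I i) ≤? t

    decisions-released : ∀ {t I} (S : RevokeSchedule I) → ReleasedBy t I →
                         decisions t S ≡ tabulate (decisionAt t ∘ outcome S)
    decisions-released {t} {I} S released =
      trans (cong (map _) (filter-all (releasedBy? t I) (All.tabulate⁺ released))) (map-tabulate _ _)

    decisions-unreleased : ∀ {t I J} (S : RevokeSchedule (J ∷ I)) → ReleasedBy t I → t < release J →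
                           decisions t S ≡ tabulate (decisionAt t ∘ outcome S ∘ suc)
    decisions-unreleased {t} {I} {J} S released t<r =
      trans (cong (map _) (trans (filter-reject (releasedBy? t (J ∷ I)) (<⇒≱ t<r))
                                 (filter-all (releasedBy? t (J ∷ I)) (All.tabulate⁺ released))))
            (map-tabulate _ _)

    -- At time `t` the job `J` is still unknown, so both runs yield the same list of decisions. As
    -- all jobs of `I` are released by `t`, both lists are full tabulations over `I` and can be
    -- compared entry by entry.
    decision-unchanged : ∀ {t I J} → ReleasedBy t I → t < release J → ∀ i →
                         decisionAt t (outcome (run I) i) ≡ decisionAt t (outcome (run (J ∷ I)) (suc i))
    decision-unchanged {t} {I} {J} released t<r = tabulate-injective $ begin
      tabulate (decisionAt t ∘ outcome (run I))              ≡⟨ decisions-released (run I) released ⟨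
      decisions t (run I)                                    ≡⟨ nonanticipating t I (J ∷ I) known-unchanged ⟩
      decisions t (run (J ∷ I))                              ≡⟨ decisions-unreleased (run (J ∷ I)) released t<r ⟩
      tabulate (decisionAt t ∘ outcome (run (J ∷ I)) ∘ suc)  ∎
      where
      open ≡-Reasoning

      known-unchanged : known t I ≡ known t (J ∷ I)
      known-unchanged = sym (filter-reject (λ J′ → release J′ ≤? t) (<⇒≱ t<r))

    -- The invariant of the adversary and one more release.

    record Trap (n : ℕ) : Set where
      field
        jobs     : Instance
        size     : length jobs ≡ n
        t T      : ℝ
        t<T      : t < T
        released : ReleasedBy t jobs
        plan     : OfflineSchedule jobs
        planned  : Planned plan
        avoids   : Avoids plan t T
        settled  : ∀ i → Settled t T (lookup jobs i) (decisionAt t (outcome (run jobs) i))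

    emptyTrap : Trap 0
    emptyTrap = record
      { jobs = [] ; size = refl ; t = 0# ; T = 1# ; t<T = 0<1 ; released = λ ()
      ; plan = record { start = λ () ; admissible = λ () ; disjoint = λ () }
      ; planned = λ () ; avoids = λ () ; settled = λ ()
      }

    module Extend {n} (trap : Trap n) where
      open Trap trap

      -- What the three cases of `next` share; here `a` is the start of `J` in the offline plan, not
      -- in the run. Old jobs remain settled: the new run repeats the old decisions up to `t`, which
      -- precedes the release of `J`, and `settled-mono` carries them on to `t′`.
      extend : ∀ J → t < release J →
               ∀ a → AdmissibleStart J a → a + processing J ≤ℝ T →
               ∀ t′ T′ → t′ < T′ → release J ≤ℝ t′ → T′ ≤ℝ T →
               (∀ x → x ∈[ a , a + processing J ⟩ → ¬ x ∈[ t′ , T′ ⟩) →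
               Settled t′ T′ J (decisionAt t′ (outcome (run (J ∷ jobs)) zero)) →
               Trap (ℕ.suc n)
      extend J t<r a adm end≤T t′ T′ t′<T′ r≤t′ T′≤T aside settledᴶ = record
        { jobs     = J ∷ jobs
        ; size     = cong ℕ.suc size
        ; t<T      = t′<T′
        ; released = λ { zero → r≤t′ ; (suc i) → ≤-trans (released i) t≤t′ }
        ; plan     = extendPlan plan avoids J a adm (≤-trans (<⇒≤ t<r) (proj₁ adm)) end≤T
        ; planned  = λ { zero → tt ; (suc i) → planned i }
        ; avoids   = λ { zero    → aside
                       ; (suc i) x busy (t′≤x , x<T′) →
                           avoids i x busy (≤-trans t≤t′ t′≤x , <-≤-trans x<T′ T′≤T) }
        ; settled  = λ { zero    → settledᴶ
                       ; (suc i) → settled-mono (outcome S (suc i)) (feasible S (suc i)) t≤t′ T′≤T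
                           (subst (Settled t T _) (decision-unchanged released t<r i) (settled i)) }
        }
        where
        S    = run (J ∷ jobs)
        t≤t′ = ≤-trans (<⇒≤ t<r) r≤t′

      next : Trap (ℕ.suc n)
      -- The release `r` is the midpoint, strictly after `t`, so that the decisions up to and
      -- including `t` cannot depend on `J`.
      next with bisect t<T
      ... | q , 0<q , t+q+q≡T
        with r ← t + q
           | t<r ← x<x+p t 0<q
           | r<T ← subst (t + q <_) t+q+q≡T (x<x+p (t + q) 0<q)
        -- With processing time and slack both `p`, the deadline of `J` is exactly `T`.
        with bisect r<T
      ... | p , 0<p , r+p+p≡T = continue (starts? (outcome S zero) (feasible S zero))
        where
        J : Job
        J = job r p p 0<p (<⇒≤ 0<p)

        S = run (J ∷ jobs)

        r<r+p : r < r + p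
        r<r+p = x<x+p r 0<p

        r+p<r+p+p : r + p < r + p + p
        r+p<r+p+p = x<x+p (r + p) 0<p

        r+p<T : r + p < T
        r+p<T = subst (r + p <_) r+p+p≡T r+p<r+p+p

        early : AdmissibleStart J r
        early = ≤-refl , <⇒≤ r<r+p

        late : AdmissibleStart J (r + p)
        late = <⇒≤ r<r+p , ≤-refl

        continue : outcome S zero ≡ unstarted ⊎
                   (∃ λ a → StartsAt (outcome S zero) a × AdmissibleStart J a) →
                   Trap (ℕ.suc n)
        continue (inj₁ eq) =
          -- At `r + p`, the latest start time of `J`, the unstarted job counts as expired.
          extend J t<r r early (<⇒≤ r+p<T) (r + p) T r+p<T (<⇒≤ r<r+p) ≤-refl
            (λ _ (_ , x<r+p) (r+p≤x , _) → <⇒≱ x<r+p r+p≤x)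
            (subst (λ o → Settled (r + p) T J (decisionAt (r + p) o)) (sym eq) ≤-refl)
        continue (inj₂ (a , startsAt , r≤a , a≤r+p)) with r + p ≤? a
        ... | yes r+p≤a =
          -- Here `a` equals `r + p`, so the algorithm cannot finish `J` before `r + p + p`.
          extend J t<r r early (<⇒≤ r+p<T) a (r + p + p) (≤-<-trans a≤r+p r+p<r+p+p) r≤a (inj₂ r+p+p≡T)
            (λ _ (_ , x<r+p) (a≤x , _) → <⇒≱ x<r+p (≤-trans r+p≤a a≤x))
            (settled-start startsAt (+-monoˡ-≤ p r+p≤a))
        ... | no r+p≰a =
          -- From `r ≤ a` follows `r + p ≤ a + p`: the algorithm cannot finish `J` before the new
          -- right end `r + p`, where the plan starts it.
          extend J t<r (r + p) late (inj₂ r+p+p≡T) a (r + p) (≰⇒> r+p≰a) r≤a (<⇒≤ r+p<T)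
            (λ _ (r+p≤x , _) (_ , x<r+p) → <⇒≱ x<r+p r+p≤x)
            (settled-start startsAt (+-monoˡ-≤ p r≤a))

    trap : ∀ n → Trap n
    trap ℕ.zero    = emptyTrap
    trap (ℕ.suc n) = Extend.next (trap n)

    -- Throughput of the run and of the plan.

    module _ {n} (trapₙ : Trap n) where
      open Trap trapₙ

      completed⇒busy : ∀ {i} → IsTrue (isCompleted (outcome (run jobs) i)) →
                       Busy (lookup jobs i) (outcome (run jobs) i) t
      completed⇒busy {i} c = settled⇒busy (outcome (run jobs) i) t<T (feasible (run jobs) i) c (settled i)

      -- Any two completed jobs would both occupy the machine at the instant `t`.
      completions≤1 : completions jobs ≤ 1
      completions≤1 =
        length-unique≤1 same (Unique.filter⁺ _ (Unique.allFin⁺ (length jobs)))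
                             (All.all-filter (T? ∘ isCompleted ∘ outcome (run jobs)) (allFin (length jobs)))
        where
        same : ∀ {i j} → IsTrue (isCompleted (outcome (run jobs) i)) →
               IsTrue (isCompleted (outcome (run jobs) j)) → i ≡ j
        same {i} {j} ci cj with i ≟ j
        ... | yes i≡j = i≡j
        ... | no  i≢j = contradiction (completed⇒busy ci , completed⇒busy cj)
                                      (RevokeSchedule.disjoint (run jobs) i j i≢j t)

      plan-optimal : IsOptimal plan
      plan-optimal plan′ = ℕ.≤-trans (throughput≤length plan′) (ℕ.≤-reflexive (sym (throughput-planned plan planned)))

      plan-throughput : n ≤ throughput plan
      plan-throughput = ℕ.≤-reflexive (sym (trans (throughput-planned plan planned) size))

theorem2 : (R : RealNumbers) →
    let open RealNumbers R hiding (_≤_) in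
    let open Scheduling R in
    ((ALG : OnlineAlgorithm) (k : ℕ) → 3 ≤ k →
    Σ[ I ∈ Instance ]
    (OnlineAlgorithm.completions ALG I ≤ 1 ×
    Σ[ OPT ∈ OfflineSchedule I ]
    (IsOptimal OPT × k ≤ OfflineSchedule.throughput OPT)))
    ×
    (∀ (c : ℝ) → 0# < c → ¬ (Σ[ ALG ∈ OnlineAlgorithm ] Competitive c ALG))
theorem2 R = (λ ALG k _ → starved ALG k) , λ c 0<c (ALG , competitive) →
  -- A `c`-competitive algorithm would give `c * k ≤ c * OPT ≤ ALG ≤ 1` for every `k`.
  multiples-unbounded 0<c (fromℕ 1) λ k →
    let I , ALG≤1 , OPT , optimal , k≤OPT = starved ALG k in
    ≤-trans (*-monoʳ-≤ 0<c (fromℕ-mono k≤OPT)) (≤-trans (competitive I OPT optimal) (fromℕ-mono ALG≤1))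
  where
  open RealNumbers R hiding (_≤_)
  open Scheduling R
  open OrderedField R
  open Adversary R

  starved : ∀ ALG k → Σ[ I ∈ Instance ]
    (OnlineAlgorithm.completions ALG I ≤ 1 ×
     Σ[ OPT ∈ OfflineSchedule I ] (IsOptimal OPT × k ≤ OfflineSchedule.throughput OPT))
  starved ALG k = let τ = trap ALG k in
    Trap.jobs τ , completions≤1 ALG τ , Trap.plan τ , plan-optimal ALG τ , plan-throughput ALG τ
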